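{- The generating function $G_3(x)=\sum_{n\ge0}g_{3,n}x^n$ for Greek key tours on height $3$ grid graphs is $$G_3(x)=\frac{1-x-x^2+4x^3-x^4}{(1-2x)(1-2x^2)}.$$
   Context: A Greek key tour on the $k\times n$ grid graph ($k$ rows, $n$ columns; vertices are integer points, edges join points at distance $1$) is a directed self-avoiding walk that starts at the upper-left corner vertex and visits every vertex of the grid exactly once. $g_{k,n}$ denotes the number of Greek key tours on the $k\times n$ grid graph, with the convention $g_{k,0}=1$. -}

module Defs where

open import Data.Bool using (if_then_else_)
open import Data.Empty using (⊥)
open import Data.Fin using (Fin; toℕ)
import Data.Fin.Properties as Fin
open import Data.Integer as ℤ using (ℤ; +_; 0ℤ)
open import Data.List as List using (List; allFin; applyUpTo; cartesianProduct; cartesianProductWith; filter; foldr; length)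
open import Data.Nat as ℕ using (ℕ; zero; suc; _+_; _*_; _∸_; _≡ᵇ_; _≟_; ∣_-_∣)
open import Data.Product using (Σ-syntax; _×_; _,_; uncurry)
open import Data.Product.Properties using (≡-dec)
open import Data.Vec using (Vec; []; _∷_)
open import Data.Vec.Membership.Propositional using (_∈_)
import Data.Vec.Membership.DecPropositional as DecMembership
open import Data.Vec.Relation.Unary.AllPairs using (allPairs?)
open import Data.Vec.Relation.Unary.Linked using (Linked; linked?)
open import Data.Vec.Relation.Unary.Unique.Propositional using (Unique)
open import Relation.Binary using (Decidable; DecidableEquality)
open import Relation.Binary.PropositionalEquality using (_≡_)
open import Relation.Nullary using (no; ¬?; _×-dec_)
open import Relation.Nullary.Decidable using (map′)
import Relation.Unary as U

-- Rows are numbered from the top and columns from the left, so the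
-- upper-left corner is (0 , 0).

Vertex : ℕ → ℕ → Set
Vertex k n = Fin k × Fin n

_≟ᵥ_ : ∀ {k n} → DecidableEquality (Vertex k n)
_≟ᵥ_ = ≡-dec Fin._≟_ Fin._≟_

distance² : ∀ {k n} → Vertex k n → Vertex k n → ℕ
distance² (r , c) (r′ , c′) =
  ∣ toℕ r - toℕ r′ ∣ ℕ.^ 2 + ∣ toℕ c - toℕ c′ ∣ ℕ.^ 2

-- Distance 1 is the same as squared distance 1.

Adjacent : ∀ {k n} → Vertex k n → Vertex k n → Set
Adjacent v w = distance² v w ≡ 1

adjacent? : ∀ {k n} → Decidable (Adjacent {k} {n})
adjacent? v w = distance² v w ≟ 1

StartsAtCorner : ∀ {k n m} → Vec (Vertex k n) m → Set
StartsAtCorner []            = ⊥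
StartsAtCorner ((r , c) ∷ _) = toℕ r ≡ 0 × toℕ c ≡ 0

startsAtCorner? : ∀ {k n m} → U.Decidable (StartsAtCorner {k} {n} {m})
startsAtCorner? []            = no λ ()
startsAtCorner? ((r , c) ∷ _) = (toℕ r ≟ 0) ×-dec (toℕ c ≟ 0)

VisitsEveryVertex : ∀ {k n m} → Vec (Vertex k n) m → Set
VisitsEveryVertex {k} {n} w = (v : Vertex k n) → v ∈ w

visitsEveryVertex? : ∀ {k n m} → U.Decidable (VisitsEveryVertex {k} {n} {m})
visitsEveryVertex? w =
  map′ uncurry (λ f r c → f (r , c))
    (Fin.all? λ r → Fin.all? λ c → (r , c) ∈? w)
  where open DecMembership _≟ᵥ_ using (_∈?_)

-- Uniqueness is self-avoidance; together with VisitsEveryVertex it says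
-- that every vertex is visited exactly once.

IsGreekKeyTour : ∀ {k n m} → Vec (Vertex k n) m → Set
IsGreekKeyTour w =
  StartsAtCorner w × Linked Adjacent w × Unique w × VisitsEveryVertex w

isGreekKeyTour? : ∀ {k n m} → U.Decidable (IsGreekKeyTour {k} {n} {m})
isGreekKeyTour? w =
  startsAtCorner? w ×-dec linked? adjacent? w
    ×-dec allPairs? (λ v v′ → ¬? (v ≟ᵥ v′)) w ×-dec visitsEveryVertex? w

allVertices : ∀ k n → List (Vertex k n)
allVertices k n = cartesianProduct (allFin k) (allFin n)

allVecs : ∀ {A : Set} → List A → ∀ m → List (Vec A m)
allVecs xs zero    = [] List.∷ List.[]
allVecs xs (suc m) = cartesianProductWith _∷_ xs (allVecs xs m)

-- A walk visiting each of the k * n vertices exactly once is a sequence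
-- of exactly k * n vertices, so only sequences of that length are searched.
-- Each such sequence occurs exactly once in the list that is filtered.

g : ℕ → ℕ → ℕ
g k zero      = 1
g k n@(suc _) = length (filter isGreekKeyTour? (allVecs (allVertices k n) (k * n)))

-- Formal power series over ℤ, given by their coefficients.

Series : Set
Series = ℕ → ℤ

infix  4 _≈_ _≐_÷_
infixl 6 _⊕_ _⊖_
infixl 7 _⊛_
infix  7.5 _·x^_

_≈_ : Series → Series → Set
f ≈ h = ∀ n → f n ≡ h n

_·x^_ : ℤ → ℕ → Series
(a ·x^ k) n = if n ≡ᵇ k then a else 0ℤ

_⊕_ _⊖_ _⊛_ : Series → Series → Series
(f ⊕ h) n = f n ℤ.+ h n
(f ⊖ h) n = f n ℤ.- h n
(f ⊛ h) n = foldr ℤ._+_ 0ℤ (applyUpTo (λ i → f i ℤ.* h (n ∸ i)) (suc n))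

-- f ≐ p ÷ q: the series q is invertible and f = p · q⁻¹.

_≐_÷_ : Series → Series → Series → Set
f ≐ p ÷ q = Σ[ q⁻¹ ∈ Series ] (q ⊛ q⁻¹ ≈ + 1 ·x^ 0) × (f ≈ p ⊛ q⁻¹)

G : ℕ → Series
G k n = + g k n

{-# OPTIONS --safe #-}
module Submission where

-- Follow the walker and look at the cells still to be visited. As soon as they fall apart into two
-- parts that cannot both be finished, the walk is lost; what survives is a handful of families.
--   * Down the first column at once: a smaller tour, upside down, or (leaving at the middle row) a
--     walk that covers everything to the right and ends in the lower left cell.
--   * Along the top row, with a 2 × j block left behind below it, and down at some column. Going
--     back left the walker must run round the block and start a smaller tour; going right it must
--     cover the rest, come back along the bottom row and end in the block, in one of j ways.
-- A walk that covers 3 × (k + 1) from the middle of the first column to the cell below its start is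
-- forced up to one binary choice every two columns. With m k the number of these walks, and a k the
-- number of tours of 3 × (k + 1), this gives
--   a (k + 1) = p (k + 1) + m k,   p (k + 1) = p k + m k + m (k + 1) + a k,   m (k + 2) = 2 m k,
-- which is the recurrence with characteristic polynomial (1 - 2x)(1 - 2x²).

open import Defs
open import Data.Bool as Bool using (Bool; true; false; if_then_else_)
open import Data.Bool.Properties using (¬-not)
open import Data.Fin using (Fin; zero; suc; toℕ)
import Data.Fin.Properties as Fin
open import Data.Integer as ℤ using (ℤ; +_; 0ℤ)
import Data.Integer.Properties as ℤ
import Data.Integer.Solver as ℤ-Solver
open import Data.List using (List; []; _∷_; _++_; map; replicate; filter; length; cartesianProductWith; cartesianProduct; allFin; tabulate; foldr; applyUpTo)
open import Data.List.Properties using (map-++; map-∘; map-cong; map-tabulate; filter-++; filter-≐; filter-accept; filter-reject; filter-none; length-++)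
open import Data.List.Relation.Binary.Permutation.Propositional using (_↭_; ↭-reflexive; module PermutationReasoning)
open import Data.List.Relation.Binary.Permutation.Propositional.Properties using (++⁺; ++-comm; map⁺)
open import Data.List.Relation.Unary.All as ListAll using (All; []; _∷_)
import Data.List.Relation.Unary.All.Properties as ListAll
open import Data.Nat using (ℕ; zero; suc; _+_; _*_; _∸_; _^_; _<_; z<s; ∣_-_∣)
open import Data.Nat.ListAction using (sum)
open import Data.Nat.ListAction.Properties using (sum-↭; sum-++)
open import Data.Nat.Properties
open import Data.Nat.Solver using (module +-*-Solver)
open import Data.Product using (_×_; _,_; proj₁; proj₂)
open import Data.Vec using (Vec; []; _∷_; lookup; _[_]≔_; updateAt) renaming (replicate to replicateᵥ)
open import Data.Vec.Membership.Propositional using (_∈_)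
open import Data.Vec.Properties using (lookup∘updateAt; lookup∘updateAt′; lookup-replicate)
open import Data.Vec.Relation.Unary.All as VecAll using ([]; _∷_)
open import Data.Vec.Relation.Unary.AllPairs using ([]; _∷_)
open import Data.Vec.Relation.Unary.Any using (here; there)
open import Data.Vec.Relation.Unary.Linked using (Linked; [-]; _∷_)
open import Data.Vec.Relation.Unary.Unique.Propositional using (Unique)
open import Function using (_∘_; _⇔_; mk⇔; Equivalence)
open import Relation.Binary.PropositionalEquality
open import Relation.Nullary using (Dec; yes; no; ¬_; contradiction; _×-dec_; does)
open import Relation.Nullary.Decidable using (dec-true; dec-false)
open import Relation.Unary using (Decidable)

-- Columns, states of the walker and moves

Column : Set
Column = Vec Bool 3

pattern column x y z = x ∷ y ∷ z ∷ []

pattern top = zero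
pattern mid = suc zero
pattern bot = suc (suc zero)

∅ only-top only-mid only-bot outer lower full : Column
∅        = column false false false
only-top = column true  false false
only-mid = column false true  false
only-bot = column false false true
outer    = column true  false true
lower    = column false true  true
full     = column true  true  true

cells : ∀ {n} → Vec Bool n → ℕ
cells []          = 0
cells (true  ∷ c) = suc (cells c)
cells (false ∷ c) = cells c

area : List Column → ℕ
area []       = 0
area (c ∷ cs) = cells c + area cs

-- Beyond the end of a strip lies `∅`, so the edge of the grid behaves like an exhausted column and
-- needs no separate case.
head : List Column → Column
head []      = ∅
head (c ∷ _) = c

tail : List Column → List Column
tail []       = []
tail (_ ∷ cs) = cs

-- Exhausted columns at the far end are dropped, so that a strip without free
-- cells is always [].
push : Column → List Column → List Column
push c                          (d ∷ cs) = c ∷ d ∷ cs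
push (column false false false) []       = []
push c                          []       = c ∷ []

-- state L r c R: the walker stands in row r of a column whose free cells are c.
-- L and R are the free cells of the columns to its left and right, nearest first.
record State : Set where
  constructor state
  field
    left    : List Column
    row     : Fin 3
    current : Column
    right   : List Column

size : State → ℕ
size (state L r c R) = cells c + (area L + area R)

guard : {A : Set} → Bool → A → List A
guard true  x = x ∷ []
guard false x = []

enter : List Column → List Column → Column → Fin 3 → List State
enter L R c r = guard (lookup c r) (state L r (c [ r ]≔ false) R)

vertical leftward rightward targets : State → List State
vertical (state L top c R) = enter L R c mid
vertical (state L mid c R) = enter L R c top ++ enter L R c bot
vertical (state L bot c R) = enter L R c mid
leftward  (state L r c R) = enter (tail L) (push c R) (head L) r
rightward (state L r c R) = enter (push c L) (tail R) (head R) r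
targets s = vertical s ++ leftward s ++ rightward s

isZero : ℕ → ℕ
isZero zero    = 1
isZero (suc _) = 0

-- The first argument is the number of moves still to be made, which makes the recursion structural.
-- A walk counts only if no free cell is left at its end.
completions : ℕ → State → ℕ
completions zero    s = isZero (size s)
completions (suc m) s = sum (map (completions m) (targets s))

-- A record rather than a bare equation, so that `s` and `c` are found by unification and
-- `completions` is not unfolded.
record Count (s : State) (c : ℕ) : Set where
  constructor counted
  field count : completions (size s) s ≡ c

-- Quantifying over all `m`, not only `size s`, allows induction on `m` without tracking sizes.
record Dead (s : State) : Set where
  constructor dead
  field none : ∀ m → completions m s ≡ 0
open Dead

-- The singleton constructor keeps a forced move from contributing a trailing `+ 0`.
data Counts : List State → ℕ → Set where
  []  : Counts [] 0
  [_] : ∀ {s c} → Count s c → Counts (s ∷ []) c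
  _∷_ : ∀ {s ss c d} → Count s c → Counts ss d → Counts (s ∷ ss) (c + d)

Occupied : List Column → Set
Occupied cs = 0 < area cs

-- Strip bookkeeping and counting by one step

area-push : ∀ c cs → area (push c cs) ≡ cells c + area cs
area-push c (d ∷ cs) = refl
area-push (column false false false) [] = refl
area-push (column false false true)  [] = refl
area-push (column false true  false) [] = refl
area-push (column false true  true)  [] = refl
area-push (column true  false false) [] = refl
area-push (column true  false true)  [] = refl
area-push (column true  true  false) [] = refl
area-push (column true  true  true)  [] = refl

head-push : ∀ c cs → head (push c cs) ≡ c
head-push c (d ∷ cs) = refl
head-push (column false false false) [] = refl
head-push (column false false true)  [] = refl
head-push (column false true  false) [] = refl
head-push (column false true  true)  [] = refl
head-push (column true  false false) [] = refl
head-push (column true  false true)  [] = refl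
head-push (column true  true  false) [] = refl
head-push (column true  true  true)  [] = refl

tail-push : ∀ c cs → tail (push c cs) ≡ cs
tail-push c (d ∷ cs) = refl
tail-push (column false false false) [] = refl
tail-push (column false false true)  [] = refl
tail-push (column false true  false) [] = refl
tail-push (column false true  true)  [] = refl
tail-push (column true  false false) [] = refl
tail-push (column true  false true)  [] = refl
tail-push (column true  true  false) [] = refl
tail-push (column true  true  true)  [] = refl

lookup-∅ : ∀ r → lookup ∅ r ≡ false
lookup-∅ top = refl
lookup-∅ mid = refl
lookup-∅ bot = refl

area-head-tail : ∀ cs → cells (head cs) + area (tail cs) ≡ area cs
area-head-tail []       = refl
area-head-tail (_ ∷ _) = refl

cells-update : ∀ {n} (c : Vec Bool n) r → lookup c r ≡ true → suc (cells (c [ r ]≔ false)) ≡ cells c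
cells-update (true  ∷ c) zero    _ = refl
cells-update (true  ∷ c) (suc r) e = cong suc (cells-update c r e)
cells-update (false ∷ c) (suc r) e = cells-update c r e

Shrinks : ℕ → State → Set
Shrinks n t = suc (size t) ≡ n

enter-shrinks : ∀ {n} L R c r → cells c + (area L + area R) ≡ n → All (Shrinks n) (enter L R c r)
enter-shrinks L R c r e with lookup c r in eq
... | true  = trans (cong (_+ (area L + area R)) (cells-update c r eq)) e ∷ []
... | false = []

vertical-shrinks : ∀ s → All (Shrinks (size s)) (vertical s)
vertical-shrinks (state L top c R) = enter-shrinks L R c mid refl
vertical-shrinks (state L mid c R) =
  ListAll.++⁺ (enter-shrinks L R c top refl) (enter-shrinks L R c bot refl)
vertical-shrinks (state L bot c R) = enter-shrinks L R c mid refl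

targets-shrink : ∀ s → All (Shrinks (size s)) (targets s)
targets-shrink s@(state L r c R) = ListAll.++⁺ (vertical-shrinks s) (ListAll.++⁺
  (enter-shrinks (tail L) (push c R) (head L) r
    (trans (cong (λ z → cells (head L) + (area (tail L) + z)) (area-push c R))
      (trans (solve 4 (λ h t x y → h :+ (t :+ (x :+ y)) := x :+ ((h :+ t) :+ y)) refl
                (cells (head L)) (area (tail L)) (cells c) (area R))
        (cong (λ z → cells c + (z + area R)) (area-head-tail L)))))
  (enter-shrinks (push c L) (tail R) (head R) r
    (trans (cong (λ z → cells (head R) + (z + area (tail R))) (area-push c L))
      (trans (solve 4 (λ h t x y → h :+ ((x :+ y) :+ t) := x :+ (y :+ (h :+ t))) refl
                (cells (head R)) (area (tail R)) (cells c) (area L))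
        (cong (λ z → cells c + (area L + z)) (area-head-tail R))))))
  where open +-*-Solver

-- Each move uses up exactly one free cell, so the counts of the targets, each taken at its own
-- size, are all taken at the same number of moves.
step : ∀ {s c} → 0 < size s → Counts (targets s) c → Count s c
step {s} {c} occ cs = counted (go (size s) refl occ)
  where
  total : ∀ m {ts c} → Counts ts c → All (Shrinks (suc m)) ts → sum (map (completions m) ts) ≡ c
  total m []                 []       = refl
  total m [ counted e ] (p ∷ []) with refl ← suc-injective p = trans (+-identityʳ _) e
  total m (counted e ∷ cs) (p ∷ ps) with refl ← suc-injective p = cong₂ _+_ e (total m cs ps)

  -- Replacing `size s` by a variable lets `completions` unfold.
  go : ∀ n → size s ≡ n → 0 < n → completions n s ≡ c
  go (suc m) eq _ = total m cs (subst (λ n → All (Shrinks n) (targets s)) eq (targets-shrink s))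

recount : ∀ {s c d} → c ≡ d → Count s c → Count s d
recount refl x = x

-- Dead states

isZero-positive : ∀ {n} → 0 < n → isZero n ≡ 0
isZero-positive z<s = refl

sum-zeros : ∀ {f : State → ℕ} {ts} → All (λ t → f t ≡ 0) ts → sum (map f ts) ≡ 0
sum-zeros []       = refl
sum-zeros (z ∷ zs) = cong₂ _+_ z (sum-zeros zs)

stuck : ∀ {s} → 0 < size s → All Dead (targets s) → Dead s
stuck occ ds = dead λ where
  zero    → isZero-positive occ
  (suc m) → sum-zeros (ListAll.map (λ d → none d m) ds)

dead⇒count : ∀ {s} → Dead s → Count s 0
dead⇒count {s} (dead z) = counted (z (size s))

-- For a move into a cell not known to be free: absent or dead, it contributes nothing either way.
skip : ∀ b {t ts c} → (b ≡ true → Dead t) → Counts ts c → Counts (guard b t ++ ts) c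
skip true  d cs = dead⇒count (d refl) ∷ cs
skip false d cs = cs

dead-guard : ∀ b {t ts} → (b ≡ true → Dead t) → All Dead ts → All Dead (guard b t ++ ts)
dead-guard true  d ds = d refl ∷ ds
dead-guard false d ds = ds

skip-last : ∀ b {t} → (b ≡ true → Dead t) → Counts (guard b t) 0
skip-last true  d = [ dead⇒count (d refl) ]
skip-last false d = []

dead-guard-last : ∀ b {t} → (b ≡ true → Dead t) → All Dead (guard b t)
dead-guard-last true  d = d refl ∷ []
dead-guard-last false d = []

blocked : ∀ {b} {A : Set} → b ≡ false → b ≡ true → A
blocked refl ()

enter-All : ∀ {P : State → Set} {L R c r} →
            (lookup c r ≡ true → P (state L r (c [ r ]≔ false) R)) → All P (enter L R c r)
enter-All {c = c} {r} p with lookup c r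
... | true  = p refl ∷ []
... | false = []

vertical-All : ∀ {P : State → Set} {L c R} → (∀ r → P (state L r (c [ r ]≔ false) R)) →
               ∀ r → All P (vertical (state L r c R))
vertical-All {c = c} p top = enter-All {c = c} λ _ → p mid
vertical-All {c = c} p mid = ListAll.++⁺ (enter-All {c = c} λ _ → p top) (enter-All {c = c} λ _ → p bot)
vertical-All {c = c} p bot = enter-All {c = c} λ _ → p mid

-- If free cells remain as long as `I` holds, no walk staying inside `I` is complete. Preservation
-- asks for zero counts instead of `I` at the targets, so that a move may also leave `I` for another
-- dead state.
dead-invariant : ∀ {I : State → Set} → (∀ {s} → I s → 0 < size s) →
                 (∀ m {s} → (∀ {t} → I t → completions m t ≡ 0) → I s →
                            All (λ t → completions m t ≡ 0) (targets s)) →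
                 ∀ {s} → I s → Dead s
dead-invariant {I} occ preserved i = dead λ m → go m i
  where
  go : ∀ m {s} → I s → completions m s ≡ 0
  go zero    i = isZero-positive (occ i)
  go (suc m) i = sum-zeros (preserved m (go m) i)

-- Cells abandoned on the left or on the right

area-++ : ∀ xs ys → area (xs ++ ys) ≡ area xs + area ys
area-++ []       ys = refl
area-++ (x ∷ xs) ys = trans (cong (_+_ (cells x)) (area-++ xs ys)) (sym (+-assoc (cells x) _ _))

occupied-++ : ∀ xs ys → Occupied ys → Occupied (xs ++ ys)
occupied-++ xs ys occ = subst (0 <_) (sym (area-++ xs ys)) (m≤n⇒m≤o+n (area xs) occ)

occupied-push : ∀ c R → Occupied R → Occupied (push c R)
occupied-push c R occ = subst (0 <_) (sym (area-push c R)) (m≤n⇒m≤o+n (cells c) occ)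

occupied-pushed : ∀ c R → 0 < cells c → Occupied (push c R)
occupied-pushed c R pos = subst (0 <_) (sym (area-push c R)) (m≤n⇒m≤n+o (area R) pos)

occupied-left : ∀ {L r c R} → Occupied L → 0 < size (state L r c R)
occupied-left {c = c} {R} occ = m≤n⇒m≤o+n (cells c) (m≤n⇒m≤n+o (area R) occ)

occupied-right : ∀ {L r c R} → Occupied R → 0 < size (state L r c R)
occupied-right {L} {c = c} occ = m≤n⇒m≤o+n (cells c) (m≤n⇒m≤o+n (area L) occ)

push-++ : ∀ c xs d K → push c (xs ++ d ∷ K) ≡ c ∷ xs ++ d ∷ K
push-++ c []       d K = refl
push-++ c (x ∷ xs) d K = refl

-- Cells d ∷ K that a walker coming from the right can never finish.
record Trap (d : Column) (K : List Column) : Set where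
  field
    occupied : Occupied (d ∷ K)
    entry    : ∀ r {R} → lookup d r ≡ true → lookup (head R) r ≡ false →
               Dead (state K r (d [ r ]≔ false) R)
open Trap

-- The walker's own cell is required to be visited: when it steps into `d`, this becomes the
-- hypothesis of `entry` that it cannot step back.
data Beyond (d : Column) (K : List Column) : State → Set where
  beyond : ∀ xs {r c R} → lookup c r ≡ false → Beyond d K (state (xs ++ d ∷ K) r c R)

head-push-lookup : ∀ c R r {b} → lookup c r ≡ b → lookup (head (push c R)) r ≡ b
head-push-lookup c R r = trans (cong (λ d → lookup d r) (head-push c R))

-- The walker either stays to the right of `d`, where the cells of `d ∷ K` remain free, or steps
-- into `d` and is dead by `entry`.
trapped : ∀ {d K} → Trap d K → ∀ {s} → Beyond d K s → Dead s
trapped {d} {K} t = dead-invariant occ moves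
  where
  occ : ∀ {s} → Beyond d K s → 0 < size s
  occ (beyond xs {r} {c} {R} _) = occupied-left {xs ++ d ∷ K} {r} {c} {R} (occupied-++ xs (d ∷ K) (occupied t))

  moves : ∀ m {s} → (∀ {t} → Beyond d K t → completions m t ≡ 0) → Beyond d K s →
          All (λ t → completions m t ≡ 0) (targets s)
  moves m ih (beyond xs {r} {c} {R} free) = ListAll.++⁺
    (vertical-All {P = λ t → completions m t ≡ 0} {c = c} (λ r′ → ih (beyond xs (lookup∘updateAt r′ c))) r)
    (ListAll.++⁺ (left xs) (enter-All {c = head R} λ _ → right))
    where
    left : ∀ xs → All (λ t → completions m t ≡ 0) (leftward (state (xs ++ d ∷ K) r c R))
    left []       = enter-All {c = d} λ e → none (entry t r e (head-push-lookup c R r free)) m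
    left (x ∷ xs) = enter-All {c = x} λ _ → ih (beyond xs (lookup∘updateAt r x))

    right : completions m (state (push c (xs ++ d ∷ K)) r (head R [ r ]≔ false) (tail R)) ≡ 0
    right rewrite push-++ c xs d K = ih (beyond (c ∷ xs) (lookup∘updateAt r (head R)))

data Walled (K : List Column) : State → Set where
  walled : ∀ xs {L r c} → Walled K (state L r c (xs ++ ∅ ∷ K))

-- No move enters an exhausted column, so the free cells of `K` behind it are never reached.
cut-off : ∀ {K} → Occupied K → ∀ {s} → Walled K s → Dead s
cut-off {K} occK = dead-invariant occ moves
  where
  occ : ∀ {s} → Walled K s → 0 < size s
  occ (walled xs {L} {r} {c}) = occupied-right {L} {r} {c} {xs ++ ∅ ∷ K} (occupied-++ xs (∅ ∷ K) occK)

  moves : ∀ m {s} → (∀ {t} → Walled K t → completions m t ≡ 0) → Walled K s →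
          All (λ t → completions m t ≡ 0) (targets s)
  moves m ih (walled xs {L} {r} {c}) = ListAll.++⁺
    (vertical-All {P = λ t → completions m t ≡ 0} {c = c} (λ _ → ih (walled xs)) r)
    (ListAll.++⁺ (enter-All {c = head L} λ _ → left) (right xs))
    where
    left : completions m (state (tail L) r (head L [ r ]≔ false) (push c (xs ++ ∅ ∷ K))) ≡ 0
    left rewrite push-++ c xs ∅ K = ih (walled (c ∷ xs))

    right : ∀ xs → All (λ t → completions m t ≡ 0) (rightward (state L r c (xs ++ ∅ ∷ K)))
    right []       = enter-All {c = ∅} {r} λ e → contradiction (trans (sym e) (lookup-∅ r)) λ ()
    right (x ∷ xs) = enter-All {c = x} λ _ → ih (walled xs)

-- Ends of walks

-- Cells d ∷ L in which a walk coming from the right has to end: it must enter at row a, when nothing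
-- else is left, and then has c ways to finish.
record Tail (a : Fin 3) (d : Column) (L : List Column) (c : ℕ) : Set where
  field
    last   : Count (state L a (d [ a ]≔ false) []) c
    excess : ∀ {R} → Occupied R → lookup (head R) a ≡ false → Dead (state L a (d [ a ]≔ false) R)
    astray : ∀ r {R} → r ≢ a → lookup d r ≡ true → lookup (head R) r ≡ false →
             Dead (state L r (d [ r ]≔ false) R)
open Tail

∅-trap : ∀ K → Occupied K → Trap ∅ K
∅-trap K occ = λ where
  .occupied → occ
  .entry top ()
  .entry mid ()
  .entry bot ()

occupied-bot : ∀ {x L} → Occupied (column false x true ∷ L)
occupied-bot {true}  = z<s
occupied-bot {false} = z<s

-- A single free bottom cell in front of a tail is a corridor to its entrance.
extend-single : ∀ {x L c} → Tail bot (column false x true) L c →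
                Tail bot only-bot (column false x true ∷ L) c
extend-single {x} {L} t = λ where
    .last → step (occ {bot} {∅} {[]}) [ t .last ]
    .excess {R} o free → stuck (occ {bot} {∅} {R})
      (t .excess (occupied-push ∅ R o) (head-push-lookup ∅ R bot refl) ∷ dead-guard-last _ (blocked free))
    .astray top _ ()
    .astray mid _ ()
    .astray bot ne → contradiction refl ne
  where
  occ : ∀ {r c R} → 0 < size (state (column false x true ∷ L) r c R)
  occ {r} {c} {R} = occupied-left {column false x true ∷ L} {r} {c} {R} (occupied-bot {x} {L})

-- The new column must be used up before leaving it at the bottom, so it is entered in the middle
-- and crossed downwards. Entered at the bottom, it either keeps its middle cell unvisited or is
-- left at the wrong row.
extend-mid : ∀ {x L c} → Tail bot (column false x true) L c →
             Tail mid lower (column false x true ∷ L) c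
extend-mid {x} {L} t = λ where
    .last → recount (+-identityʳ _)
      (step z<s (step (occ {bot} {∅} {[]}) [ t .last ] ∷ skip x (λ e → t .astray mid (λ ()) e refl) []))
    .excess {R} o free → stuck z<s
      ( stuck (occ {bot} {∅} {R})
          ( t .excess (occupied-push ∅ R o) (head-push-lookup ∅ R bot refl)
          ∷ dead-guard-last _ (λ _ → abandoned bot R))
      ∷ dead-guard x (λ e → t .astray mid (λ ()) e (head-push-lookup only-bot R mid refl))
          (dead-guard-last _ (blocked free)))
    .astray top _ ()
    .astray mid ne → contradiction refl ne
    .astray bot {R} _ _ free → stuck z<s
      ( stuck (occ {mid} {∅} {R})
          (dead-guard x (λ e → t .astray mid (λ ()) e (head-push-lookup ∅ R mid refl))
            (dead-guard-last _ (λ _ → abandoned mid R)))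
      ∷ t .excess (occupied-pushed only-mid R z<s) (head-push-lookup only-mid R bot refl)
      ∷ dead-guard-last _ (blocked free))
  where
  occ : ∀ {r c R} → 0 < size (state (column false x true ∷ L) r c R)
  occ {r} {c} {R} = occupied-left {column false x true ∷ L} {r} {c} {R} (occupied-bot {x} {L})

  abandoned : ∀ r R → Dead (state (∅ ∷ column false x true ∷ L) r (head R [ r ]≔ false) (tail R))
  abandoned r R = trapped (∅-trap (column false x true ∷ L) (occupied-bot {x} {L})) (beyond [] (lookup∘updateAt r (head R)))

-- The same argument with middle and bottom exchanged. Along the top row the entrance thus
-- alternates between the two rows, which is the source of the period two in `turn`.
extend-bot : ∀ {L c} → Tail mid lower L c → Tail bot lower (lower ∷ L) c
extend-bot {L} t = λ where
    .last → recount (+-identityʳ _)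
      (step z<s (step z<s [ t .last ] ∷ [ dead⇒count (t .astray bot (λ ()) refl refl) ]))
    .excess {R} o free → stuck z<s
      ( stuck z<s
          ( t .excess (occupied-push ∅ R o) (head-push-lookup ∅ R mid refl)
          ∷ dead-guard-last _ (λ _ → abandoned mid R))
      ∷ t .astray bot (λ ()) refl (head-push-lookup only-mid R bot refl)
      ∷ dead-guard-last _ (blocked free))
    .astray top _ ()
    .astray mid {R} _ _ free → stuck z<s
      ( stuck z<s
          ( t .astray bot (λ ()) refl (head-push-lookup ∅ R bot refl)
          ∷ dead-guard-last _ (λ _ → abandoned bot R))
      ∷ t .excess (occupied-pushed only-bot R z<s) (head-push-lookup only-bot R mid refl)
      ∷ dead-guard-last _ (blocked free))
    .astray bot ne → contradiction refl ne
  where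
  abandoned : ∀ r R → Dead (state (∅ ∷ lower ∷ L) r (head R [ r ]≔ false) (tail R))
  abandoned r R = trapped (∅-trap (lower ∷ L) z<s) (beyond [] (lookup∘updateAt r (head R)))

-- Covering full columns and returning to a tail

-- With k full columns to the right and a tail to the left, a walker in the middle of its column has
-- turn k ways to cover them and return to the tail; one in the top row has entrance k or turn k ways,
-- depending on whether the tail is entered at the bottom or in the middle.
turn entrance : ℕ → ℕ
turn zero    = 0
turn (suc k) = entrance k
entrance zero    = 1
entrance (suc k) = turn k + turn k

-- Mutual induction on `k`. The only real choice is in `from-corner`: down once and then right
-- (`from-middle`), or right along the top (`from-side`). From there the walk is forced back to
-- `from-corner` one column further on; every other move abandons cells or enters the tail wrongly.
from-corner : ∀ {x L c} → Tail bot (column false x true) L c → ∀ k →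
              Count (state (column false x true ∷ L) top lower (replicate k full)) (c * entrance k)
from-side : ∀ {L c} → Tail mid lower L c → ∀ k →
            Count (state (lower ∷ L) top lower (replicate k full)) (c * turn k)
from-middle : ∀ {L c} → Tail bot only-bot L c → ∀ k →
              Count (state (only-bot ∷ L) mid outer (replicate k full)) (c * turn k)

from-corner {x} {L} {c} t zero = recount (eq c) (step z<s
    [ step z<s
      ( step (occupied-left {column false x true ∷ L} {bot} {∅} {[]} (occupied-bot {x} {L})) [ t .last ]
      ∷ skip x (λ e → t .astray mid (λ ()) e refl) []) ])
  where
  eq : ∀ c → c + 0 ≡ c * 1
  eq c = trans (+-identityʳ c) (sym (*-identityʳ c))
from-corner {x} {L} {c} t (suc k) = recount (sym (*-distribˡ-+ c (turn k) (turn k))) (step z<s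
    ( step z<s
      -- At the bottom, going left enters the tail with full columns still unvisited, and going
      -- right shuts the tail off behind an exhausted column.
      ( dead⇒count (stuck (occupied-left {dL} {bot} {∅} {full ∷ F} (occupied-bot {x} {L}))
          ( t .excess z<s refl
          ∷ trapped (∅-trap (column false x true ∷ L) (occupied-bot {x} {L})) (beyond [] refl) ∷ []))
      ∷ skip x (λ e → t .astray mid (λ ()) e refl)
          [ from-middle (extend-single t) k ])
    ∷ [ from-side (extend-mid t) k ]))
  where
  dL = column false x true ∷ L
  F = replicate k full

from-middle {L} {c} t zero = recount (sym (*-zeroʳ c)) (step z<s
  ( dead⇒count (stuck z<s [])
  ∷ [ dead⇒count (stuck z<s (t .excess z<s refl ∷ [])) ]))
from-middle {L} {c} t (suc k) = recount (+-identityʳ _) (step z<s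
  ( step z<s [ from-corner (extend-single t) k ]
  ∷ dead⇒count (stuck z<s (t .excess z<s refl ∷ trapped top-trap (beyond [] refl) ∷ []))
  ∷ [ dead⇒count (trapped outer-trap (beyond [] refl)) ]))
  where
  -- The top cell left behind is a dead end, while the tail is still unvisited.
  top-trap : Trap only-top (only-bot ∷ L)
  top-trap .occupied = z<s
  top-trap .entry top _ free = stuck z<s (dead-guard-last _ (blocked free))
  top-trap .entry mid ()
  top-trap .entry bot ()

  -- Entered at the top, the column is a dead end; entered at the bottom, it leads into the tail
  -- with the top cell still free.
  outer-trap : Trap outer (only-bot ∷ L)
  outer-trap .occupied = z<s
  outer-trap .entry top _ free = stuck z<s (dead-guard-last _ (blocked free))
  outer-trap .entry mid ()
  outer-trap .entry bot {R} _ free = stuck z<s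
    ( t .excess (occupied-pushed only-top R z<s) (head-push-lookup only-top R bot refl)
    ∷ dead-guard-last _ (blocked free))

from-side {L} {c} t zero = recount (sym (*-zeroʳ c)) (step z<s
  [ step z<s
    ( dead⇒count (stuck z<s (t .astray bot (λ ()) refl refl ∷ []))
    ∷ [ dead⇒count (t .excess z<s refl) ]) ])
from-side {L} {c} t (suc k) = step z<s
  ( step z<s
    ( dead⇒count (stuck z<s (t .astray bot (λ ()) refl refl ∷ trapped (∅-trap (lower ∷ L) z<s) (beyond [] refl) ∷ []))
    ∷ dead⇒count (t .excess z<s refl)
    ∷ [ dead⇒count (trapped bot-trap (beyond [] refl)) ])
  ∷ [ from-corner (extend-bot t) k ])
  where
  -- This corridor reaches the tail at the bottom, but the tail has to be entered in the middle.
  bot-trap : Trap only-bot (lower ∷ L)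
  bot-trap .occupied = z<s
  bot-trap .entry top ()
  bot-trap .entry mid ()
  bot-trap .entry bot {R} _ free = stuck z<s
    ( t .astray bot (λ ()) refl (head-push-lookup ∅ R bot refl)
    ∷ dead-guard-last _ (blocked free))

-- The block left behind below the top row

block : ℕ → List Column
block j = replicate j lower


-- With cells on the right still to be visited, the only way is left along the middle row and back
-- along the bottom row. Descending before the far end separates the rest of the block from the
-- cells on the right. `ret` takes over when the walker is back below its start.
loop-mid : ∀ j {x R c} → Occupied (x ∷ R) → lookup x mid ≡ false →
           Count (state [] bot ∅ (x ∷ R)) c →
           Count (state (block j) mid only-bot (x ∷ R)) c
loop-mid zero o free ret = recount (+-identityʳ _) (step z<s (ret ∷ skip-last _ (blocked free)))
loop-mid (suc j) {x} {R} o free ret = recount (+-identityʳ _) (step z<s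
  ( dead⇒count (stuck z<s
      ( cut-off o (walled [])
      ∷ dead-guard-last _ (λ _ → trapped (∅-trap (block (suc j)) z<s) (beyond [] (lookup∘updateAt bot x)))))
  ∷ loop-mid j z<s refl (step z<s [ ret ])
  ∷ skip-last _ (blocked free)))

loop-bot : ∀ j {x R c} → Occupied (x ∷ R) → lookup x bot ≡ false →
           Count (state [] mid ∅ (x ∷ R)) c →
           Count (state (block j) bot only-mid (x ∷ R)) c
loop-bot zero o free ret = recount (+-identityʳ _) (step z<s (ret ∷ skip-last _ (blocked free)))
loop-bot (suc j) {x} {R} o free ret = recount (+-identityʳ _) (step z<s
  ( dead⇒count (stuck z<s
      ( cut-off o (walled [])
      ∷ dead-guard-last _ (λ _ → trapped (∅-trap (block (suc j)) z<s) (beyond [] (lookup∘updateAt mid x)))))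
  ∷ loop-bot j z<s refl (step z<s [ ret ])
  ∷ skip-last _ (blocked free)))

done : ∀ {r} → Count (state [] r ∅ []) 1
done = counted refl

-- Finishing the current column first gives the same problem on one column less, upside down; moving
-- left at once forces the single loop. Each column thus adds one way.
fill-mid : ∀ j → Count (state (block j) mid only-bot []) (suc j)
fill-bot : ∀ j → Count (state (block j) bot only-mid []) (suc j)
fill-mid zero    = step z<s [ done ]
fill-mid (suc j) = recount (+-comm (suc j) 1) (step z<s
  (step z<s [ fill-bot j ] ∷ [ loop-mid j z<s refl (step z<s [ done ]) ]))
fill-bot zero    = step z<s [ done ]
fill-bot (suc j) = recount (+-comm (suc j) 1) (step z<s
  (step z<s [ fill-mid j ] ∷ [ loop-bot j z<s refl (step z<s [ done ]) ]))

-- Walking into the block exhausts the column in front of it, so whatever is left on the right is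
-- cut off.
block-tail : ∀ j → Tail bot only-bot (block (suc j)) (suc j)
block-tail j = λ where
  .last → step z<s [ fill-bot j ]
  .excess {x ∷ R} o free → stuck z<s (cut-off o (walled []) ∷ dead-guard-last _ (blocked free))
  .astray top _ ()
  .astray mid _ ()
  .astray bot ne → contradiction refl ne

single-tail : Tail bot only-bot [] 1
single-tail = λ where
  .last → done
  .excess {R} o free → stuck (occupied-right {[]} {bot} {∅} {R} o) (dead-guard-last _ (blocked free))
  .astray top _ ()
  .astray mid _ ()
  .astray bot ne → contradiction refl ne

-- Reflection in the middle row

flipColumn : Column → Column
flipColumn (column x y z) = column z y x

flipRow : Fin 3 → Fin 3
flipRow top = bot
flipRow mid = mid
flipRow bot = top

flip : State → State
flip (state L r c R) = state (map flipColumn L) (flipRow r) (flipColumn c) (map flipColumn R)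

cells-flip : ∀ c → cells (flipColumn c) ≡ cells c
cells-flip (column false false false) = refl
cells-flip (column false false true)  = refl
cells-flip (column false true  false) = refl
cells-flip (column false true  true)  = refl
cells-flip (column true  false false) = refl
cells-flip (column true  false true)  = refl
cells-flip (column true  true  false) = refl
cells-flip (column true  true  true)  = refl

area-flip : ∀ cs → area (map flipColumn cs) ≡ area cs
area-flip []       = refl
area-flip (c ∷ cs) = cong₂ _+_ (cells-flip c) (area-flip cs)

size-flip : ∀ s → size (flip s) ≡ size s
size-flip (state L r c R) = cong₂ _+_ (cells-flip c) (cong₂ _+_ (area-flip L) (area-flip R))

lookup-flip : ∀ c r → lookup (flipColumn c) (flipRow r) ≡ lookup c r
lookup-flip (column x y z) top = refl
lookup-flip (column x y z) mid = refl
lookup-flip (column x y z) bot = refl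

update-flip : ∀ c r → flipColumn c [ flipRow r ]≔ false ≡ flipColumn (c [ r ]≔ false)
update-flip (column x y z) top = refl
update-flip (column x y z) mid = refl
update-flip (column x y z) bot = refl

head-flip : ∀ cs → head (map flipColumn cs) ≡ flipColumn (head cs)
head-flip []      = refl
head-flip (_ ∷ _) = refl

tail-flip : ∀ cs → tail (map flipColumn cs) ≡ map flipColumn (tail cs)
tail-flip []      = refl
tail-flip (_ ∷ _) = refl

push-flip : ∀ c cs → push (flipColumn c) (map flipColumn cs) ≡ map flipColumn (push c cs)
push-flip c (d ∷ cs) = refl
push-flip (column false false false) [] = refl
push-flip (column false false true)  [] = refl
push-flip (column false true  false) [] = refl
push-flip (column false true  true)  [] = refl
push-flip (column true  false false) [] = refl
push-flip (column true  false true)  [] = refl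
push-flip (column true  true  false) [] = refl
push-flip (column true  true  true)  [] = refl

enter-flip : ∀ L R c r → enter (map flipColumn L) (map flipColumn R) (flipColumn c) (flipRow r) ≡ map flip (enter L R c r)
enter-flip L R c r rewrite lookup-flip c r with lookup c r
... | true  = cong (λ d → state _ _ d _ ∷ []) (update-flip c r)
... | false = refl

-- Reflection exchanges the two vertical moves from the middle row, so the lists agree only up to
-- order, which suffices for sums.
vertical-flip : ∀ s → vertical (flip s) ↭ map flip (vertical s)
vertical-flip (state L top c R) = ↭-reflexive (enter-flip L R c mid)
vertical-flip (state L mid c R) = begin
  enter L′ R′ c′ top ++ enter L′ R′ c′ bot            ↭⟨ ++-comm (enter L′ R′ c′ top) _ ⟩
  enter L′ R′ c′ bot ++ enter L′ R′ c′ top            ≡⟨ cong₂ _++_ (enter-flip L R c top) (enter-flip L R c bot) ⟩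
  map flip (enter L R c top) ++ map flip (enter L R c bot) ≡⟨ map-++ flip (enter L R c top) _ ⟨
  map flip (enter L R c top ++ enter L R c bot)       ∎
  where
  open PermutationReasoning
  L′ = map flipColumn L
  R′ = map flipColumn R
  c′ = flipColumn c
vertical-flip (state L bot c R) = ↭-reflexive (enter-flip L R c mid)

leftward-flip : ∀ s → leftward (flip s) ≡ map flip (leftward s)
leftward-flip (state L r c R) rewrite head-flip L | tail-flip L | push-flip c R =
  enter-flip (tail L) (push c R) (head L) r

rightward-flip : ∀ s → rightward (flip s) ≡ map flip (rightward s)
rightward-flip (state L r c R) rewrite head-flip R | tail-flip R | push-flip c L =
  enter-flip (push c L) (tail R) (head R) r

targets-flip : ∀ s → targets (flip s) ↭ map flip (targets s)
targets-flip s = begin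
  vertical (flip s) ++ leftward (flip s) ++ rightward (flip s)
    ↭⟨ ++⁺ (vertical-flip s) (↭-reflexive (cong₂ _++_ (leftward-flip s) (rightward-flip s))) ⟩
  map flip (vertical s) ++ map flip (leftward s) ++ map flip (rightward s)
    ≡⟨ cong (map flip (vertical s) ++_) (map-++ flip (leftward s) _) ⟨
  map flip (vertical s) ++ map flip (leftward s ++ rightward s)
    ≡⟨ map-++ flip (vertical s) _ ⟨
  map flip (targets s) ∎
  where open PermutationReasoning

completions-flip : ∀ m s → completions m (flip s) ≡ completions m s
completions-flip zero    s = cong isZero (size-flip s)
completions-flip (suc m) s = begin
  sum (map (completions m) (targets (flip s)))    ≡⟨ sum-↭ (map⁺ (completions m) (targets-flip s)) ⟩
  sum (map (completions m) (map flip (targets s))) ≡⟨ cong sum (map-∘ (targets s)) ⟨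
  sum (map (λ t → completions m (flip t)) (targets s)) ≡⟨ cong sum (map-cong (completions-flip m) (targets s)) ⟩
  sum (map (completions m) (targets s))           ∎
  where open ≡-Reasoning

flipped : ∀ {s c} → Count s c → Count (flip s) c
flipped {s} (counted e) = counted (trans (cong (λ n → completions n (flip s)) (size-flip s))
                                    (trans (completions-flip (size s) s) e))

-- Recursion for the tours

-- straight k + j * slope k counts the ways to go on from the top row with k columns to the right and
-- 2 × j cells left behind.
tours straight slope : ℕ → ℕ
slope k = turn k + turn (suc k)
tours zero    = 1
tours (suc k) = straight (suc k) + turn k
straight zero    = 1
straight (suc k) = straight k + slope k + tours k

flip-full : ∀ k → map flipColumn (replicate k full) ≡ replicate k full
flip-full zero    = refl
flip-full (suc k) = cong (full ∷_) (flip-full k)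

from-top : ∀ k → Count (state [] top lower (replicate k full)) (tours k)
from-bot : ∀ k → Count (state [] bot ∅ (replicate (suc k) full)) (tours k)
-- The count is affine in the number of columns of the block: a walk either runs round the block, in
-- one way, or ends inside it, in as many ways as it has columns. Each step right adds a column to
-- it.
from-block : ∀ j k → Count (state (block (suc j)) top lower (replicate k full))
                           (straight k + suc j * slope k)

from-top zero    = step z<s [ step z<s [ done ] ]
from-top (suc k) = recount (eq (straight k) (slope k) (tours k) (turn k)) (step z<s
  ( step z<s (from-bot k ∷ [ from-middle single-tail k ])
  ∷ [ from-block 0 k ]))
  where
  open +-*-Solver
  eq : ∀ p s a m → (a + 1 * m) + (p + 1 * s) ≡ p + s + a + m
  eq = solve 4 (λ p s a m → (a :+ con 1 :* m) :+ (p :+ con 1 :* s) := p :+ s :+ a :+ m) refl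

-- The step right leads to a bottom corner, which reflection turns into the start of a tour.
from-bot k = step z<s [ subst (λ F → Count (state [] bot (column true true false) F) (tours k)) (flip-full k) (flipped (from-top k)) ]

from-block j zero = recount (eq j) (step z<s
  [ step z<s
    ( step z<s [ fill-bot j ]
    ∷ [ loop-mid j z<s refl (step z<s [ done ]) ]) ])
  where
  eq : ∀ j → suc j + 1 ≡ 1 + suc j * 1
  eq j = trans (+-comm (suc j) 1) (cong suc (sym (*-identityʳ (suc j))))
from-block j (suc k) = recount (eq (suc j) (straight k) (tours k) (turn k) (turn (suc k))) (step z<s
  ( step z<s
    ( dead⇒count (stuck z<s
        ( cut-off z<s (walled [])
        ∷ trapped (∅-trap (block (suc j)) z<s) (beyond [] refl)
        ∷ []))
    ∷ loop-mid j z<s refl (step z<s [ from-bot k ])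
    ∷ [ from-middle (block-tail j) k ])
  ∷ [ from-block (suc j) k ]))
  where
  open +-*-Solver
  eq : ∀ j p a m n → (a + j * m) + (p + suc j * (m + n)) ≡ (p + (m + n) + a) + j * (n + (m + m))
  eq = solve 5 (λ j p a m n → (a :+ j :* m) :+ (p :+ (con 1 :+ j) :* (m :+ n)) :=
                 (p :+ (m :+ n) :+ a) :+ j :* (n :+ (m :+ m))) refl

private variable
  n m : ℕ

-- Sums over the vertices

count-map : ∀ {A B : Set} {P : B → Set} (P? : Decidable P) (f : A → B) xs →
            length (filter P? (map f xs)) ≡ length (filter (P? ∘ f) xs)
count-map P? f []       = refl
count-map P? f (x ∷ xs) with does (P? (f x))
... | true  = cong suc (count-map P? f xs)
... | false = count-map P? f xs

count-product : ∀ {A B C : Set} {P : C → Set} (P? : Decidable P) (f : A → B → C) xs ys →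
                length (filter P? (cartesianProductWith f xs ys)) ≡
                sum (map (λ x → length (filter (P? ∘ f x) ys)) xs)
count-product P? f []       ys = refl
count-product P? f (x ∷ xs) ys = begin
  length (filter P? (map (f x) ys ++ rest))
    ≡⟨ cong length (filter-++ P? (map (f x) ys) rest) ⟩
  length (filter P? (map (f x) ys) ++ filter P? rest)
    ≡⟨ length-++ (filter P? (map (f x) ys)) ⟩
  length (filter P? (map (f x) ys)) + length (filter P? rest)
    ≡⟨ cong₂ _+_ (count-map P? (f x) ys) (count-product P? f xs ys) ⟩
  length (filter (P? ∘ f x) ys) + sum (map (λ x → length (filter (P? ∘ f x) ys)) xs) ∎
  where
  open ≡-Reasoning
  rest = cartesianProductWith f xs ys

sum-product : ∀ {A B : Set} (h : A × B → ℕ) xs ys →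
              sum (map h (cartesianProduct xs ys)) ≡ sum (map (λ x → sum (map (λ y → h (x , y)) ys)) xs)
sum-product h []       ys = refl
sum-product h (x ∷ xs) ys = begin
  sum (map h (map (x ,_) ys ++ rest))             ≡⟨ cong sum (map-++ h (map (x ,_) ys) rest) ⟩
  sum (map h (map (x ,_) ys) ++ map h rest)       ≡⟨ sum-++ (map h (map (x ,_) ys)) _ ⟩
  sum (map h (map (x ,_) ys)) + sum (map h rest)
    ≡⟨ cong₂ _+_ (cong sum (sym (map-∘ ys))) (sum-product h xs ys) ⟩
  sum (map (λ y → h (x , y)) ys) + sum (map (λ x → sum (map (λ y → h (x , y)) ys)) xs) ∎
  where
  open ≡-Reasoning
  rest = cartesianProduct xs ys

sum-vertices : ∀ (h : Vertex 3 n → ℕ) →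
  sum (map h (allVertices 3 n)) ≡
  sum (tabulate (λ c → h (top , c))) + (sum (tabulate (λ c → h (mid , c))) + sum (tabulate (λ c → h (bot , c))))
sum-vertices {n} h = trans (sum-product h (allFin 3) (allFin n))
  (cong₂ _+_ (row top) (cong₂ _+_ (row mid) (trans (+-identityʳ _) (row bot))))
  where
  row : ∀ r → sum (map (λ c → h (r , c)) (allFin n)) ≡ sum (tabulate (λ c → h (r , c)))
  row r = cong sum (map-tabulate (λ c → c) (λ c → h (r , c)))

sum-zero : ∀ {f : Fin n → ℕ} → (∀ c → f c ≡ 0) → sum (tabulate f) ≡ 0
sum-zero {zero}  z = refl
sum-zero {suc n} z = cong₂ _+_ (z zero) (sum-zero (z ∘ suc))

sum-single : ∀ {f : Fin n → ℕ} c → (∀ c′ → c′ ≢ c → f c′ ≡ 0) → sum (tabulate f) ≡ f c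
sum-single {f = f} zero z = trans (cong (_+_ (f zero)) (sum-zero (λ c → z (suc c) λ ()))) (+-identityʳ _)
sum-single (suc c) z = cong₂ _+_ (z zero λ ()) (sum-single c (λ c′ ne → z (suc c′) (ne ∘ Fin.suc-injective)))

-- The value at the neighbouring column, or 0 if that column would lie outside the grid.
before after : Fin n → (Fin n → ℕ) → ℕ
before zero          f = 0
before (suc zero)    f = f zero
before (suc (suc c)) f = before (suc c) (f ∘ suc)
after {suc zero}    zero    f = 0
after {suc (suc _)} zero    f = f (suc zero)
after               (suc c) f = after c (f ∘ suc)

sum-beside : ∀ {f h : Fin n → ℕ} c →
             (∀ c′ → ∣ toℕ c - toℕ c′ ∣ ≢ 1 → f c′ ≡ 0) →
             (∀ c′ → ∣ toℕ c - toℕ c′ ∣ ≡ 1 → f c′ ≡ h c′) →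
             sum (tabulate f) ≡ before c h + after c h
sum-beside {suc zero}    zero z e = cong₂ _+_ (z zero λ ()) refl
sum-beside {suc (suc n)} {f} {h} zero z e = cong₂ _+_ (z zero λ ())
  (trans (cong₂ _+_ (e (suc zero) refl) (sum-zero λ c → z (suc (suc c)) λ ())) (+-identityʳ _))
sum-beside (suc zero)    z e = cong₂ _+_ (e zero refl) (sum-beside zero (z ∘ suc) (e ∘ suc))
sum-beside (suc (suc c)) z e = cong₂ _+_ (z zero λ ()) (sum-beside (suc c) (z ∘ suc) (e ∘ suc))

-- Walks in the grid

Grid : ℕ → Set
Grid n = Vec Column n

free : Grid n → Vertex 3 n → Bool
free g (r , c) = lookup (lookup g c) r

visit : Grid n → Vertex 3 n → Grid n
visit g (r , c) = updateAt g c (_[ r ]≔ false)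

free-visit-self : ∀ (g : Grid n) w → free (visit g w) w ≡ false
free-visit-self g (r , c) =
  trans (cong (λ x → lookup x r) (lookup∘updateAt c g)) (lookup∘updateAt r (lookup g c))

free-visit-other : ∀ (g : Grid n) w {u} → u ≢ w → free (visit g w) u ≡ free g u
free-visit-other g (r , c) {r′ , c′} ne with c′ Fin.≟ c
... | no c′≢c   = cong (λ x → lookup x r′) (lookup∘updateAt′ c′ c c′≢c g)
... | yes refl = trans (cong (λ x → lookup x r′) (lookup∘updateAt c g))
                   (lookup∘updateAt′ r′ r (λ { refl → ne refl }) (lookup g c))

-- Self-avoidance and covering are checked move by move against the cells still free, so that
-- counting routes splits over the first move just as `completions` does.
Route : Grid n → Vertex 3 n → Vec (Vertex 3 n) m → Set
Route g v []      = ∀ r c → free g (r , c) ≡ false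
Route g v (w ∷ t) = (Adjacent v w × free g w ≡ true) × Route (visit g w) w t

route? : ∀ (g : Grid n) v → Decidable (Route {n} {m} g v)
route? g v []      = Fin.all? λ r → Fin.all? λ c → free g (r , c) Bool.≟ false
route? g v (w ∷ t) = (adjacent? v w ×-dec (free g w Bool.≟ true)) ×-dec route? (visit g w) w t

Covers : Grid n → Vec (Vertex 3 n) m → Set
Covers g t = Unique t × VecAll.All (λ u → free g u ≡ true) t × (∀ u → free g u ≡ true → u ∈ t)

covers⇒route : ∀ (g : Grid n) {v} {t : Vec (Vertex 3 n) m} → Linked Adjacent (v ∷ t) → Covers g t → Route g v t
covers⇒route g {t = []} _ (_ , _ , all) r c = ¬-not λ e → absurd (all _ e)
  where
  absurd : ∀ {u} → u ∈ [] → _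
  absurd ()
covers⇒route g {t = w ∷ t} (a ∷ l) (fresh ∷ uniq , f ∷ fs , all) =
  (a , f) , covers⇒route (visit g w) l (uniq , frees fresh fs , cover)
  where
  frees : ∀ {k} {xs : Vec _ k} → VecAll.All (w ≢_) xs → VecAll.All (λ u → free g u ≡ true) xs → VecAll.All (λ u → free (visit g w) u ≡ true) xs
  frees []       []       = []
  frees (n ∷ ns) (f ∷ fs) = trans (free-visit-other g w (n ∘ sym)) f ∷ frees ns fs

  cover : ∀ u → free (visit g w) u ≡ true → u ∈ t
  cover u e with u ≟ᵥ w
  ... | yes refl = contradiction (trans (sym e) (free-visit-self g w)) λ ()
  ... | no ne with all u (trans (sym (free-visit-other g w ne)) e)
  ...   | here eq = contradiction eq ne
  ...   | there i = i

route⇒covers : ∀ (g : Grid n) {v} {t : Vec (Vertex 3 n) m} → Route g v t → Linked Adjacent (v ∷ t) × Covers g t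
route⇒covers g {t = []} none = [-] , [] , [] , λ u e → contradiction (trans (sym e) (none _ _)) λ ()
route⇒covers g {t = w ∷ t} ((a , f) , rt) with route⇒covers (visit g w) rt
... | l , uniq , fs , all = a ∷ l , VecAll.map fresh fs ∷ uniq , f ∷ VecAll.map still fs , cover
  where
  fresh : ∀ {u} → free (visit g w) u ≡ true → w ≢ u
  fresh e refl = contradiction (trans (sym e) (free-visit-self g w)) λ ()

  still : ∀ {u} → free (visit g w) u ≡ true → free g u ≡ true
  still e = trans (sym (free-visit-other g w (fresh e ∘ sym))) e

  cover : ∀ u → free g u ≡ true → u ∈ w ∷ t
  cover u e with u ≟ᵥ w
  ... | yes eq = here eq
  ... | no ne  = there (all u (trans (free-visit-other g w ne) e))

routes : ∀ m → Grid n → Vertex 3 n → ℕ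
routes {n} m g v = length (filter (route? g v) (allVecs (allVertices 3 n) m))

count-× : ∀ {A B : Set} {P : B → Set} (a? : Dec A) (P? : Decidable P) xs →
          length (filter (λ x → a? ×-dec P? x) xs) ≡ (if does a? then length (filter P? xs) else 0)
count-× (yes a) P? xs = cong length (filter-≐ _ P? (proj₂ , (a ,_)) xs)
count-× (no ¬a) P? xs = cong length (filter-none _ (ListAll.universal (λ x → ¬a ∘ proj₁) xs))

routes-suc : ∀ m (g : Grid n) v → routes (suc m) g v ≡
  sum (map (λ w → if does (adjacent? v w ×-dec (free g w Bool.≟ true)) then routes m (visit g w) w else 0)
           (allVertices 3 n))
routes-suc {n} m g v = trans (count-product (route? g v) _∷_ (allVertices 3 n) (allVecs (allVertices 3 n) m))
  (cong sum (map-cong (λ w → count-× (adjacent? v w ×-dec (free g w Bool.≟ true)) (route? (visit g w) w) (allVecs (allVertices 3 n) m))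
                      (allVertices 3 n)))

-- From the grid to the walker's view

strip : Grid n → List Column
strip []       = []
strip (x ∷ xs) = push x (strip xs)

-- `L` accumulates the columns already passed, nearest first; statements about `focus` are therefore
-- proved for general `L` where possible.
focus : List Column → Grid n → Fin n → Fin 3 → State
focus L (x ∷ xs) zero    r = state L r x (strip xs)
focus L (x ∷ xs) (suc c) r = focus (push x L) xs c r

successors : List Column → Grid n → Vertex 3 n → List State
successors L g (r , c) = guard (free g (r , c)) (focus L (visit g (r , c)) c r)

weigh : ℕ → List State → ℕ
weigh m ts = sum (map (completions m) ts)

weigh-++ : ∀ m ts us → weigh m (ts ++ us) ≡ weigh m ts + weigh m us
weigh-++ m ts us = trans (cong sum (map-++ (completions m) ts us)) (sum-++ (map (completions m) ts) _)

above-below : Fin 3 → (Fin 3 → ℕ) → ℕ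
above-below top f = f mid
above-below mid f = f top + f bot
above-below bot f = f mid

weigh-vertical : ∀ m L (g : Grid n) r c →
  weigh m (vertical (focus L g c r)) ≡ above-below r (λ r′ → weigh m (successors L g (r′ , c)))
weigh-vertical m L (x ∷ g) top zero    = refl
weigh-vertical m L (x ∷ g) mid zero    = weigh-++ m (enter L (strip g) x top) _
weigh-vertical m L (x ∷ g) bot zero    = refl
weigh-vertical m L (x ∷ g) top (suc c) = weigh-vertical m (push x L) g top c
weigh-vertical m L (x ∷ g) mid (suc c) = weigh-vertical m (push x L) g mid c
weigh-vertical m L (x ∷ g) bot (suc c) = weigh-vertical m (push x L) g bot c

weigh-rightward : ∀ m L (g : Grid n) r c →
  weigh m (rightward (focus L g c r)) ≡ after c (λ c′ → weigh m (successors L g (r , c′)))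
weigh-rightward m L (x ∷ []) r zero rewrite lookup-∅ r = refl
weigh-rightward m L (x ∷ y ∷ g) r zero rewrite head-push y (strip g) | tail-push y (strip g) = refl
weigh-rightward m L (x ∷ g) r (suc c) = weigh-rightward m (push x L) g r c

-- In column 0 the left neighbour would come from `L`, which is not part of `g`. A general `L` thus
-- works only for a later column.
weigh-leftward-suc : ∀ m L (g : Grid (suc n)) r c →
  weigh m (leftward (focus L g (suc c) r)) ≡ before (suc c) (λ c′ → weigh m (successors L g (r , c′)))
weigh-leftward-suc m L (x ∷ y ∷ g) r zero rewrite head-push x L | tail-push x L = refl
weigh-leftward-suc m L (x ∷ g) r (suc c) = weigh-leftward-suc m (push x L) g r c

weigh-leftward : ∀ m (g : Grid n) r c →
  weigh m (leftward (focus [] g c r)) ≡ before c (λ c′ → weigh m (successors [] g (r , c′)))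
weigh-leftward m (x ∷ g) r zero rewrite lookup-∅ r = refl
weigh-leftward m g@(_ ∷ _) r (suc c) = weigh-leftward-suc m [] g r c

weigh-targets : ∀ m (g : Grid n) r c → let f = λ w → weigh m (successors [] g w) in
  weigh m (targets (focus [] g c r)) ≡
  above-below r (λ r′ → f (r′ , c)) + (before c (λ c′ → f (r , c′)) + after c (λ c′ → f (r , c′)))
weigh-targets m g r c = begin
  weigh m (vertical s ++ leftward s ++ rightward s)
    ≡⟨ weigh-++ m (vertical s) _ ⟩
  weigh m (vertical s) + weigh m (leftward s ++ rightward s)
    ≡⟨ cong₂ _+_ (weigh-vertical m [] g r c)
         (trans (weigh-++ m (leftward s) _) (cong₂ _+_ (weigh-leftward m g r c) (weigh-rightward m [] g r c))) ⟩
  _ ∎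
  where
  open ≡-Reasoning
  s = focus [] g c r

adjacent-column : ∀ (c c′ : Fin n) → ∣ toℕ c - toℕ c′ ∣ ^ 2 ≡ 0 → c′ ≡ c
adjacent-column c c′ e = sym (Fin.toℕ-injective (∣m-n∣≡0⇒m≡n (m^n≡0⇒m≡0 _ 2 e)))

square≡1 : ∀ d → d ^ 2 ≡ 1 → d ≡ 1
square≡1 d e = m*n≡1⇒m≡1 d (d ^ 1) e

on-column : ∀ (c : Fin n) → ∣ toℕ c - toℕ c ∣ ^ 2 ≡ 0
on-column c rewrite ∣n-n∣≡0 (toℕ c) = refl

-- By rows: the row of `(r , c)` contributes its two sides, an adjacent row only the vertex in
-- column `c`, and a row two away nothing, since squared distances there are at least 4.
neighbour-sum : ∀ r c {h f : Vertex 3 n → ℕ} →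
  (∀ w → ¬ Adjacent (r , c) w → h w ≡ 0) → (∀ w → Adjacent (r , c) w → h w ≡ f w) →
  sum (map h (allVertices 3 n)) ≡
  above-below r (λ r′ → f (r′ , c)) + (before c (λ c′ → f (r , c′)) + after c (λ c′ → f (r , c′)))
neighbour-sum {n} r c {h} {f} z e = trans (sum-vertices h) (arrange r z e)
  where
  row : Fin 3 → ℕ
  row r = sum (tabulate (λ c′ → h (r , c′)))

  Far Near : Fin 3 → Set
  Far  r = ∀ w → ¬ Adjacent (r , c) w → h w ≡ 0
  Near r = ∀ w → Adjacent (r , c) w → h w ≡ f w

  sides : Fin 3 → ℕ
  sides r = before c (λ c′ → f (r , c′)) + after c (λ c′ → f (r , c′))

  same : ∀ r → (∀ c′ → distance² (r , c) (r , c′) ≡ ∣ toℕ c - toℕ c′ ∣ ^ 2) → Far r → Near r → row r ≡ sides r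
  same r d z e = sum-beside c
    (λ c′ ne → z (r , c′) λ a → ne (square≡1 _ (trans (sym (d c′)) a)))
    (λ c′ eq → e (r , c′) (trans (d c′) (cong (_^ 2) eq)))

  next : ∀ r r′ → (∀ c′ → distance² (r , c) (r′ , c′) ≡ suc (∣ toℕ c - toℕ c′ ∣ ^ 2)) → Far r → Near r → row r′ ≡ f (r′ , c)
  next r r′ d z e = trans
    (sum-single c (λ c′ ne → z (r′ , c′) λ a → ne (adjacent-column c c′ (suc-injective (trans (sym (d c′)) a)))))
    (e (r′ , c) (trans (d c) (cong suc (on-column c))))

  far : ∀ r r′ → (∀ c′ → distance² (r , c) (r′ , c′) ≢ 1) → Far r → row r′ ≡ 0
  far r r′ d z = sum-zero (λ c′ → z (r′ , c′) (d c′))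

  arrange : ∀ r → Far r → Near r →
            row top + (row mid + row bot) ≡ above-below r (λ r′ → f (r′ , c)) + sides r
  arrange top z e
    rewrite same top (λ _ → refl) z e | next top mid (λ _ → refl) z e | far top bot (λ _ ()) z =
    trans (cong (_+_ (sides top)) (+-identityʳ _)) (+-comm (sides top) _)
  arrange mid z e
    rewrite same mid (λ _ → refl) z e | next mid top (λ _ → refl) z e | next mid bot (λ _ → refl) z e =
    trans (cong (_+_ (f (top , c))) (+-comm (sides mid) _)) (sym (+-assoc (f (top , c)) _ _))
  arrange bot z e
    rewrite same bot (λ _ → refl) z e | next bot mid (λ _ → refl) z e | far bot top (λ _ ()) z = refl

cells-none : ∀ (x : Vec Bool n) → (∀ r → lookup x r ≡ false) → cells x ≡ 0
cells-none []          none = refl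
cells-none (true  ∷ x) none = contradiction (none zero) λ ()
cells-none (false ∷ x) none = cells-none x (none ∘ suc)

none-cells : ∀ (x : Vec Bool n) → cells x ≡ 0 → ∀ r → lookup x r ≡ false
none-cells (false ∷ x) e zero    = refl
none-cells (false ∷ x) e (suc r) = none-cells x e r

total : Grid n → ℕ
total []       = 0
total (x ∷ g) = cells x + total g

total-none : ∀ (g : Grid n) → (∀ r c → free g (r , c) ≡ false) → total g ≡ 0
total-none []      none = refl
total-none (x ∷ g) none = cong₂ _+_ (cells-none x (λ r → none r zero)) (total-none g (λ r c → none r (suc c)))

none-total : ∀ (g : Grid n) → total g ≡ 0 → ∀ r c → free g (r , c) ≡ false
none-total (x ∷ g) e r zero    = none-cells x (m+n≡0⇒m≡0 (cells x) e) r
none-total (x ∷ g) e r (suc c) = none-total g (m+n≡0⇒n≡0 (cells x) e) r c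

area-strip : ∀ (g : Grid n) → area (strip g) ≡ total g
area-strip []      = refl
area-strip (x ∷ g) = trans (area-push x (strip g)) (cong (_+_ (cells x)) (area-strip g))

size-focus : ∀ L (g : Grid n) c r → size (focus L g c r) ≡ area L + total g
size-focus L (x ∷ g) zero r = begin
  cells x + (area L + area (strip g)) ≡⟨ cong (λ z → cells x + (area L + z)) (area-strip g) ⟩
  cells x + (area L + total g)        ≡⟨ +-assoc (cells x) (area L) (total g) ⟨
  cells x + area L + total g          ≡⟨ cong (_+ total g) (+-comm (cells x) (area L)) ⟩
  area L + cells x + total g          ≡⟨ +-assoc (area L) (cells x) (total g) ⟩
  area L + (cells x + total g)        ∎
  where open ≡-Reasoning
size-focus L (x ∷ g) (suc c) r = begin
  size (focus (push x L) g c r)  ≡⟨ size-focus (push x L) g c r ⟩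
  area (push x L) + total g      ≡⟨ cong (_+ total g) (trans (area-push x L) (+-comm (cells x) (area L))) ⟩
  area L + cells x + total g     ≡⟨ +-assoc (area L) (cells x) (total g) ⟩
  area L + (cells x + total g)   ∎
  where open ≡-Reasoning

count-if-zero : ∀ {A : Set} {P : A → Set} (P? : Decidable P) x k → (k ≡ 0 → P x) → (P x → k ≡ 0) →
                length (filter P? (x ∷ [])) ≡ isZero k
count-if-zero P? x zero    p _ = cong length (filter-accept P? (p refl))
count-if-zero P? x (suc k) _ q = cong length (filter-reject P? (1+n≢0 ∘ q))

-- Induction on the number of moves: both counts split over the free neighbours of the current
-- vertex.
routes≡completions : ∀ m (g : Grid n) r c → routes m g (r , c) ≡ completions m (focus [] g c r)
routes≡completions zero g r c = count-if-zero (route? g (r , c)) [] (size (focus [] g c r))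
  (λ e → none-total g (trans (sym (size-focus [] g c r)) e))
  (λ none → trans (size-focus [] g c r) (total-none g none))
routes≡completions (suc m) g r c = begin
  routes (suc m) g (r , c)                ≡⟨ routes-suc m g (r , c) ⟩
  sum (map h (allVertices 3 _))           ≡⟨ neighbour-sum r c far near ⟩
  above-below r (λ r′ → f (r′ , c)) + (before c (λ c′ → f (r , c′)) + after c (λ c′ → f (r , c′)))
                                          ≡⟨ weigh-targets m g r c ⟨
  completions (suc m) (focus [] g c r)    ∎
  where
  open ≡-Reasoning
  h f : Vertex 3 _ → ℕ
  h w = if does (adjacent? (r , c) w ×-dec (free g w Bool.≟ true)) then routes m (visit g w) w else 0
  f w = weigh m (successors [] g w)

  far : ∀ w → ¬ Adjacent (r , c) w → h w ≡ 0
  far w na rewrite dec-false (adjacent? (r , c) w) na = refl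

  near : ∀ w → Adjacent (r , c) w → h w ≡ f w
  near w@(r′ , c′) a rewrite dec-true (adjacent? (r , c) w) a with free g w
  ... | true  = trans (routes≡completions m (visit g w) r′ c′) (sym (+-identityʳ _))
  ... | false = refl

-- Tours as routes from the corner

unvisited : ∀ n → Grid n
unvisited n = replicateᵥ n full

free-unvisited : ∀ (w : Vertex 3 n) → free (unvisited n) w ≡ true
free-unvisited {n} (r , c) = trans (cong (λ x → lookup x r) (lookup-replicate c full)) (lookup-replicate r true)

tour⇔route : ∀ {w} {t : Vec (Vertex 3 (suc n)) m} →
  IsGreekKeyTour (w ∷ t) ⇔ (w ≡ (top , zero) × Route (visit (unvisited _) (top , zero)) (top , zero) t)
tour⇔route {n} {w = w} {t} = mk⇔ to from
  where
  g₀ = unvisited (suc n)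
  corner : Vertex 3 (suc n)
  corner = top , zero

  to : IsGreekKeyTour (w ∷ t) → w ≡ corner × Route (visit g₀ corner) corner t
  to ((e , e′) , l , uniq@(fresh ∷ u) , all) with refl ← Fin.toℕ-injective {i = proj₁ w} {top} e
                                          | refl ← Fin.toℕ-injective {i = proj₂ w} {zero} e′ =
    refl , covers⇒route (visit g₀ corner) l (u , VecAll.map frees fresh , cover)
    where
    frees : ∀ {u} → corner ≢ u → free (visit g₀ corner) u ≡ true
    frees {u} ne = trans (free-visit-other g₀ corner (ne ∘ sym)) (free-unvisited {suc n} u)

    cover : ∀ u → free (visit g₀ corner) u ≡ true → u ∈ t
    cover u f with all u
    ... | here refl = contradiction (trans (sym f) (free-visit-self g₀ corner)) λ ()
    ... | there i   = i

  from : w ≡ corner × Route (visit g₀ corner) corner t → IsGreekKeyTour (w ∷ t)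
  from (refl , rt) with route⇒covers (visit g₀ corner) rt
  ... | l , uniq , fs , all = (refl , refl) , l , VecAll.map fresh fs ∷ uniq , cover
    where
    fresh : ∀ {u} → free (visit g₀ corner) u ≡ true → corner ≢ u
    fresh f refl = contradiction (trans (sym f) (free-visit-self g₀ corner)) λ ()

    cover : ∀ u → u ∈ corner ∷ t
    cover u with u ≟ᵥ corner
    ... | yes eq = here eq
    ... | no ne  = there (all u (trans (free-visit-other g₀ corner ne) (free-unvisited {suc n} u)))

strip-unvisited : ∀ n → strip (unvisited n) ≡ replicate n full
strip-unvisited zero    = refl
strip-unvisited (suc n) = trans (cong (push full) (strip-unvisited n)) (push-full n)
  where
  push-full : ∀ n → push full (replicate n full) ≡ full ∷ replicate n full
  push-full zero    = refl
  push-full (suc n) = refl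

g≡tours : ∀ n → g 3 (suc n) ≡ tours n
g≡tours n = begin
  g 3 (suc n)
    ≡⟨ count-product isGreekKeyTour? _∷_ (allVertices 3 (suc n)) vecs ⟩
  sum (map (λ w → length (filter (λ t → isGreekKeyTour? (w ∷ t)) vecs)) (allVertices 3 (suc n)))
    ≡⟨ cong sum (map-cong (λ w → trans
         (cong length (filter-≐ _ (λ t → (w ≟ᵥ corner) ×-dec route? g₁ corner t)
           ((λ {t} → Equivalence.to tour⇔route) , (λ {t} → Equivalence.from tour⇔route)) vecs))
         (count-× (w ≟ᵥ corner) (route? g₁ corner) vecs)) (allVertices 3 (suc n))) ⟩
  sum (map h (allVertices 3 (suc n)))
    ≡⟨ sum-vertices h ⟩
  sum (tabulate (λ c → h (top , c))) + (sum (tabulate (λ c → h (mid , c))) + sum (tabulate (λ c → h (bot , c))))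
    ≡⟨ cong₂ _+_ (sum-single {f = λ c → h (top , c)} zero λ c ne → elsewhere {top , c} (ne ∘ cong proj₂))
         (cong₂ _+_ (sum-zero λ c → elsewhere {mid , c} λ ()) (sum-zero λ c → elsewhere {bot , c} λ ())) ⟩
  routes rest g₁ corner + 0
    ≡⟨ +-identityʳ _ ⟩
  routes rest g₁ corner
    ≡⟨ routes≡completions rest g₁ top zero ⟩
  completions rest (state [] top lower (strip (unvisited n)))
    ≡⟨ cong (λ F → completions rest (state [] top lower F)) (strip-unvisited n) ⟩
  completions rest (state [] top lower (replicate n full))
    ≡⟨ cong (λ k → completions k (state [] top lower (replicate n full))) rest≡size ⟩
  completions (size (state [] top lower (replicate n full))) (state [] top lower (replicate n full))
    ≡⟨ Count.count (from-top n) ⟩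
  tours n ∎
  where
  open ≡-Reasoning
  -- `3 * suc n` reduces to `suc rest`: one vertex for the corner and `rest` moves.
  rest = n + 2 * suc n
  vecs = allVecs (allVertices 3 (suc n)) rest
  corner : Vertex 3 (suc n)
  corner = top , zero
  g₁ = visit (unvisited (suc n)) corner
  h : Vertex 3 (suc n) → ℕ
  h w = if does (w ≟ᵥ corner) then routes rest g₁ corner else 0

  elsewhere : ∀ {w} → w ≢ corner → h w ≡ 0
  elsewhere {w} ne rewrite dec-false (w ≟ᵥ corner) ne = refl

  area-full : ∀ n → area (replicate n full) ≡ n * 3
  area-full zero    = refl
  area-full (suc n) = cong (_+_ 3) (area-full n)

  rest≡size : rest ≡ 2 + area (replicate n full)
  rest≡size = trans (solve 1 (λ n → n :+ con 2 :* (con 1 :+ n) := con 2 :+ n :* con 3) refl n)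
                (cong (_+_ 2) (sym (area-full n)))
    where open +-*-Solver

-- Power series

numerator denominator : Series
numerator   = + 1 ·x^ 0 ⊖ + 1 ·x^ 1 ⊖ + 1 ·x^ 2 ⊕ + 4 ·x^ 3 ⊖ + 1 ·x^ 4
denominator = (+ 1 ·x^ 0 ⊖ + 2 ·x^ 1) ⊛ (+ 1 ·x^ 0 ⊖ + 2 ·x^ 2)

-- The denominator expands to 1 - 2x - 2x² + 4x³; its recurrence is solved for the newest
-- coefficient.
reciprocal : Series
reciprocal 0 = + 1
reciprocal 1 = + 2
reciprocal 2 = + 6
reciprocal (suc (suc (suc n))) =
  + 2 ℤ.* reciprocal (suc (suc n)) ℤ.+ + 2 ℤ.* reciprocal (suc n) ℤ.- + 4 ℤ.* reciprocal n

⊛-tail : ∀ (f h : Series) n → (∀ i → f i ≡ 0ℤ) →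
         foldr ℤ._+_ 0ℤ (applyUpTo (λ i → f i ℤ.* h i) n) ≡ 0ℤ
⊛-tail f h zero    z = refl
⊛-tail f h (suc n) z = cong₂ ℤ._+_ (trans (cong (ℤ._* h 0) (z 0)) (ℤ.*-zeroˡ (h 0)))
                                   (⊛-tail (λ i → f (suc i)) (λ i → h (suc i)) n (λ i → z (suc i)))

-- The first two summands vanish because the second factor has degree 2, the others because the
-- first factor has degree 1.
denominator-vanishes : ∀ n → denominator (4 + n) ≡ 0ℤ
denominator-vanishes n = cong (λ z → 0ℤ ℤ.+ (0ℤ ℤ.+ z))
  (⊛-tail (λ i → (+ 1 ·x^ 0 ⊖ + 2 ·x^ 1) (2 + i))
          (λ i → (+ 1 ·x^ 0 ⊖ + 2 ·x^ 2) (4 + n ∸ (2 + i))) (3 + n) (λ _ → refl))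

denominator-reciprocal : denominator ⊛ reciprocal ≈ + 1 ·x^ 0
denominator-reciprocal 0 = refl
denominator-reciprocal 1 = refl
denominator-reciprocal 2 = refl
denominator-reciprocal (suc (suc (suc n))) = trans
  (cong (λ z → denominator 0 ℤ.* r 3 ℤ.+ (denominator 1 ℤ.* r 2 ℤ.+ (denominator 2 ℤ.* r 1 ℤ.+ (denominator 3 ℤ.* r 0 ℤ.+ z))))
        (⊛-tail (λ i → denominator (4 + i)) (λ i → reciprocal (3 + n ∸ (4 + i))) n denominator-vanishes))
  (solve 3 (λ a b c → con (+ 1) :* (con (+ 2) :* a :+ con (+ 2) :* b :- con (+ 4) :* c) :+
                      (con (ℤ.- + 2) :* a :+ (con (ℤ.- + 2) :* b :+ (con (+ 4) :* c :+ con 0ℤ))) := con 0ℤ)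
         refl (r 2) (r 1) (r 0))
  where
  open ℤ-Solver.+-*-Solver
  r : ℕ → ℤ
  r i = reciprocal (i + n)

-- Everything later is a linear form in `straight k`, `tours k`, `turn k` and `turn (suc k)`. The
-- recurrence begins at `tours 1`; one index earlier it fails, in keeping with a numerator of degree
-- 4.
tours-recurrence : ∀ k → tours (4 + k) + 4 * tours (1 + k) ≡ 2 * tours (3 + k) + 2 * tours (2 + k)
tours-recurrence k = solve 4
  (λ p a m n → let
      s₀ = m :+ n ; m₂ = m :+ m ; m₃ = n :+ n
      p₁ = p :+ s₀ :+ a ; a₁ = p₁ :+ m
      p₂ = p₁ :+ (n :+ m₂) :+ a₁ ; a₂ = p₂ :+ n
      p₃ = p₂ :+ (m₂ :+ m₃) :+ a₂ ; a₃ = p₃ :+ m₂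
      p₄ = p₃ :+ (m₃ :+ (m₂ :+ m₂)) :+ a₃ ; a₄ = p₄ :+ m₃
    in a₄ :+ con 4 :* a₁ := con 2 :* a₃ :+ con 2 :* a₂)
  refl (straight k) (tours k) (turn k) (turn (suc k))
  where open +-*-Solver

-- The coefficient of the quotient at 4 + n: from the degree of the numerator on, all five of its
-- coefficients contribute.
expansion : ℕ → ℤ
expansion n = r 4 ℤ.- r 3 ℤ.- r 2 ℤ.+ + 4 ℤ.* r 1 ℤ.- r 0
  where
  r : ℕ → ℤ
  r i = reciprocal (i + n)

quotient-tail : ∀ n → (numerator ⊛ reciprocal) (4 + n) ≡ expansion n
quotient-tail n = trans
  (cong (λ z → numerator 0 ℤ.* r 4 ℤ.+ (numerator 1 ℤ.* r 3 ℤ.+ (numerator 2 ℤ.* r 2 ℤ.+ (numerator 3 ℤ.* r 1 ℤ.+ (numerator 4 ℤ.* r 0 ℤ.+ z)))))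
        (⊛-tail (λ i → numerator (5 + i)) (λ i → reciprocal (4 + n ∸ (5 + i))) n (λ _ → refl)))
  (solve 5 (λ a b c d e →
      con (+ 1) :* a :+ (con (ℤ.- + 1) :* b :+ (con (ℤ.- + 1) :* c :+ (con (+ 4) :* d :+ (con (ℤ.- + 1) :* e :+ con 0ℤ))))
      := a :- b :- c :+ con (+ 4) :* d :- e)
    refl (r 4) (r 3) (r 2) (r 1) (r 0))
  where
  open ℤ-Solver.+-*-Solver
  r : ℕ → ℤ
  r i = reciprocal (i + n)

expansion-recurrence : ∀ n → expansion (3 + n) ≡
  + 2 ℤ.* expansion (2 + n) ℤ.+ + 2 ℤ.* expansion (1 + n) ℤ.- + 4 ℤ.* expansion n
expansion-recurrence n = solve 3 (λ a b c → let
    next = λ x y z → con (+ 2) :* z :+ con (+ 2) :* y :- con (+ 4) :* x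
    d = next a b c ; e = next b c d ; f = next c d e ; g = next d e f ; h = next e f g
    value = λ x₀ x₁ x₂ x₃ x₄ → x₄ :- x₃ :- x₂ :+ con (+ 4) :* x₁ :- x₀
  in value d e f g h :=
     con (+ 2) :* value c d e f g :+ con (+ 2) :* value b c d e f :- con (+ 4) :* value a b c d e)
  refl (reciprocal n) (reciprocal (1 + n)) (reciprocal (2 + n))
  where open ℤ-Solver.+-*-Solver

-- Both sides obey the same recurrence of order three and agree at three computed values. The index
-- is 3 + n because `tours n` belongs to n + 1 columns.
tours-expansion : ∀ n → + tours (3 + n) ≡ expansion n
tours-expansion 0 = refl
tours-expansion 1 = refl
tours-expansion 2 = refl
tours-expansion (suc (suc (suc n))) = begin
  + tours (6 + n)
    -- The recurrence over the naturals has its negative term moved to the left, so that term is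
    -- added and subtracted here.
    ≡⟨ solve 2 (λ x y → x := (x :+ y) :- y) refl (+ tours (6 + n)) (+ (4 * tours (3 + n))) ⟩
  + (tours (6 + n) + 4 * tours (3 + n)) ℤ.- + (4 * tours (3 + n))
    ≡⟨ cong₂ (λ x y → + x ℤ.- y) (tours-recurrence (2 + n)) (ℤ.pos-* 4 (tours (3 + n))) ⟩
  + (2 * tours (5 + n)) ℤ.+ + (2 * tours (4 + n)) ℤ.- + 4 ℤ.* + tours (3 + n)
    ≡⟨ cong₂ (λ x y → x ℤ.+ y ℤ.- + 4 ℤ.* + tours (3 + n)) (ℤ.pos-* 2 (tours (5 + n))) (ℤ.pos-* 2 (tours (4 + n))) ⟩
  + 2 ℤ.* + tours (5 + n) ℤ.+ + 2 ℤ.* + tours (4 + n) ℤ.- + 4 ℤ.* + tours (3 + n)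
    ≡⟨ cong₂ ℤ._-_ (cong₂ (λ x y → + 2 ℤ.* x ℤ.+ + 2 ℤ.* y) (tours-expansion (suc (suc n))) (tours-expansion (suc n)))
                   (cong (+ 4 ℤ.*_) (tours-expansion n)) ⟩
  + 2 ℤ.* expansion (2 + n) ℤ.+ + 2 ℤ.* expansion (1 + n) ℤ.- + 4 ℤ.* expansion n
    ≡⟨ expansion-recurrence n ⟨
  expansion (3 + n) ∎
  where
  open ≡-Reasoning
  open ℤ-Solver.+-*-Solver

tours≡quotient : ∀ n → + tours n ≡ (numerator ⊛ reciprocal) (suc n)
tours≡quotient 0 = refl
tours≡quotient 1 = refl
tours≡quotient 2 = refl
tours≡quotient (suc (suc (suc n))) = trans (tours-expansion n) (sym (quotient-tail n))

-- Splitting n further would make Agda enumerate the walks of a fixed strip.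
G₃-expansion : G 3 ≈ numerator ⊛ reciprocal
G₃-expansion zero    = refl
G₃-expansion (suc n) = trans (cong +_ (g≡tours n)) (tours≡quotient n)

mainTheorem8 : G 3 ≐ (+ 1 ·x^ 0 ⊖ + 1 ·x^ 1 ⊖ + 1 ·x^ 2 ⊕ + 4 ·x^ 3 ⊖ + 1 ·x^ 4)
    ÷ ((+ 1 ·x^ 0 ⊖ + 2 ·x^ 1) ⊛ (+ 1 ·x^ 0 ⊖ + 2 ·x^ 2))
mainTheorem8 = reciprocal , denominator-reciprocal , G₃-expansion
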